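{- For all integers $n,m\geq 0$, $$A_{n+m,m}=\sum_{j=0}^{m}\binom{m}{j}V_{n+j},\qquad A_{n+m+1,m+1}=\sum_{j=0}^{m}\binom{m}{j}B_{n+j}.$$
   Context: A partition of a finite set is a collection of nonempty, pairwise disjoint subsets (blocks) whose union is the set; a singleton of a partition is a block with exactly one element. $B_n$ denotes the $n$-th Bell number (number of partitions of $\{1,\dots,n\}$, $B_0=1$), and $V_n$ the number of partitions of $\{1,\dots,n\}$ with no singletons ($V_0=1$). For integers $0\leq k\leq n$, $A_{n,k}$ denotes the number of partitions of $\{1,2,\dots,n+1\}$ whose largest singleton is $k+1$ (i.e. $\{k+1\}$ is a block and no $j>k+1$ forms a singleton block). -}

module Defs where

open import Data.Nat using (ℕ; zero; suc; _+_; _≡ᵇ_; _≤ᵇ_; _<ᵇ_)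
open import Data.Bool using (Bool; true; false; _∧_; if_then_else_; not)
open import Data.List using (List; []; _∷_; map; concatMap; upTo; filter; length; drop; foldr)
open import Data.Bool.ListAction using (all)
open import Relation.Nullary.Decidable using (yes; no)
open import Data.Bool.Properties using (T?)

-- Set partitions of {0,…,n-1} are encoded canonically by restricted growth
-- strings (RGS): a list [a₀,…,a_{n-1}] with a₀ = 0 (for n>0) and
-- aᵢ ≤ 1 + max(a₀,…,a_{i-1}); the blocks are the fibres {i | aᵢ = c}.
-- This is a bijection between RGS of length n and partitions of an n-set
-- (blocks labelled in order of their least element).

allSeqs : ℕ → ℕ → List (List ℕ)
allSeqs b zero = [] ∷ []
allSeqs b (suc len) = concatMap (λ x → map (x ∷_) (allSeqs b len)) (upTo b)

-- k = number of blocks opened so far; the next label may be any c ≤ k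
isRGSFrom : ℕ → List ℕ → Bool
isRGSFrom k [] = true
isRGSFrom k (x ∷ xs) = (x ≤ᵇ k) ∧ isRGSFrom (if x ≡ᵇ k then suc k else k) xs

isRGS : List ℕ → Bool
isRGS = isRGSFrom 0

Partitions : ℕ → List (List ℕ)
Partitions n = filter (λ s → T? (isRGS s)) (allSeqs n n)

occ : ℕ → List ℕ → ℕ
occ c [] = 0
occ c (x ∷ xs) = if x ≡ᵇ c then suc (occ c xs) else occ c xs

labelAt : ℕ → List ℕ → ℕ
labelAt i s = foldr (λ x _ → x) 0 (drop i s)

isSingleton : List ℕ → ℕ → Bool
isSingleton s i = (i <ᵇ length s) ∧ (occ (labelAt i s) s ≡ᵇ 1)

noSingletons : List ℕ → Bool
noSingletons s = all (λ i → not (isSingleton s i)) (upTo (length s))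

B : ℕ → ℕ
B n = length (Partitions n)

V : ℕ → ℕ
V n = length (filter (λ s → T? (noSingletons s)) (Partitions n))

-- in the 0-indexed encoding of {1,…,n+1} as {0,…,n}, element k+1 is index k.
-- largest singleton is index k: {k} is a block and no j > k is a singleton block
largestSingletonIs : List ℕ → ℕ → Bool
largestSingletonIs s k =
  isSingleton s k ∧ all (λ j → not (isSingleton s j)) (map (λ t → suc (k + t)) (upTo (length s)))

-- A n k = number of partitions of {1,…,n+1} whose largest singleton is k+1
A : ℕ → ℕ → ℕ
A n k = length (filter (λ s → T? (largestSingletonIs s k)) (Partitions (suc n)))

{-# OPTIONS --safe #-}
-- Deleting the singleton {m+1} turns a partition counted by A (n+m) m into a partition of an
-- (n+m)-set none of whose last n elements is a singleton.  Marking every position of a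
-- restricted growth string as free, nonSingleton or singleton, the number of strings obeying
-- the marks is a transfer count driven only by the numbers of open blocks and of singleton
-- blocks that still have to grow.  In this recursion a free position is the sum of a
-- nonSingleton one and a deleted one, so the count W m n for m free followed by n nonSingleton
-- positions satisfies W (m+1) n = W m (n+1) + W m n.  With Pascal's rule this expands W m n in
-- the V's, and B k = V (k+1) + V k turns the expansion of W (m+1) n into one in the B's.
module Submission where

open import Defs
open import Data.Nat
  using (ℕ; zero; suc; _+_; _*_; pred; _≤_; _<_; _≤′_; ≤′-refl; ≤′-step; _≡ᵇ_; _≤ᵇ_; z≤n; s≤s; z<s)
open import Data.Nat.Properties
open import Data.Nat.Combinatorics using (_C_; nCk+nC[k+1]≡[n+1]C[k+1]; k>n⇒nCk≡0)
open import Data.Nat.ListAction using (sum)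
open import Data.Nat.ListAction.Properties using (sum-++)
open import Data.Nat.Tactic.RingSolver using (solve-∀)
open import Data.Bool using (Bool; true; false; _∧_; not; if_then_else_)
open import Data.Bool.Properties using (T?; ∧-identityʳ; ∧-assoc; ∧-comm; ∧-commutativeMonoid; if-float; if-eta)
open import Data.Bool.ListAction using (all; and)
open import Data.List using (List; []; _∷_; _++_; [_]; map; upTo; replicate; length; filter; foldl; concatMap)
open import Data.List.Properties
  using (upTo-∷ʳ; map-++; ++-assoc; ++-identityʳ; foldl-∷ʳ; length-++; length-replicate; map-∘)
open import Data.List.Relation.Unary.All using (All; []; _∷_)
open import Data.Product using (_×_; _,_; ∃-syntax)
open import Relation.Binary.PropositionalEquality
  using (_≡_; _≢_; refl; sym; trans; cong; cong₂; subst; module ≡-Reasoning)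
open import Relation.Nullary using (Dec)
open import Relation.Nullary.Reflects using (ofʸ; ofⁿ; det)
open import Data.Empty using (⊥-elim)
open import Data.Sum using (inj₁; inj₂)
open import Function using (_∘_)
open import Algebra.Bundles using (CommutativeMonoid)
open import Algebra.Properties.CommutativeSemigroup (CommutativeMonoid.commutativeSemigroup ∧-commutativeMonoid)
  using () renaming (interchange to ∧-interchange; x∙yz≈y∙xz to ∧-exchange)
open import Algebra.Properties.CommutativeSemigroup +-commutativeSemigroup
  using () renaming (interchange to +-interchange; x∙yz≈y∙xz to +-exchange)

open ≡-Reasoning

≡ᵇ-refl : ∀ n → (n ≡ᵇ n) ≡ true
≡ᵇ-refl n = det (Dec.proof (n ≟ n)) (ofʸ refl)

≢⇒≡ᵇ-false : ∀ {m n} → m ≢ n → (m ≡ᵇ n) ≡ false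
≢⇒≡ᵇ-false {m} {n} m≢n = det (Dec.proof (m ≟ n)) (ofⁿ m≢n)

cong₃ : ∀ {A B C D : Set} (f : A → B → C → D) {a a′ b b′ c c′} →
  a ≡ a′ → b ≡ b′ → c ≡ c′ → f a b c ≡ f a′ b′ c′
cong₃ f refl refl refl = refl

∑ : ℕ → (ℕ → ℕ) → ℕ
∑ zero    f = 0
∑ (suc n) f = f n + ∑ n f

syntax ∑ n (λ i → e) = ∑[ i < n ] e

⋀ : ℕ → (ℕ → Bool) → Bool
⋀ zero    f = true
⋀ (suc n) f = f n ∧ ⋀ n f

syntax ⋀ n (λ i → e) = ⋀[ i < n ] e

∑-cong : ∀ n {f g} → (∀ i → i < n → f i ≡ g i) → ∑ n f ≡ ∑ n g
∑-cong zero    eq = refl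
∑-cong (suc n) eq = cong₂ _+_ (eq n (n<1+n n)) (∑-cong n (λ i i<n → eq i (m<n⇒m<1+n i<n)))

⋀-cong : ∀ n {f g} → (∀ i → i < n → f i ≡ g i) → ⋀ n f ≡ ⋀ n g
⋀-cong zero    eq = refl
⋀-cong (suc n) eq = cong₂ _∧_ (eq n (n<1+n n)) (⋀-cong n (λ i i<n → eq i (m<n⇒m<1+n i<n)))

∑-head : ∀ n f → ∑ (suc n) f ≡ f 0 + ∑[ i < n ] f (suc i)
∑-head zero    f = refl
∑-head (suc n) f = trans (cong (f (suc n) +_) (∑-head n f)) (+-exchange (f (suc n)) (f 0) _)

⋀-head : ∀ n f → ⋀ (suc n) f ≡ f 0 ∧ ⋀[ i < n ] f (suc i)
⋀-head zero    f = refl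
⋀-head (suc n) f = trans (cong (f (suc n) ∧_) (⋀-head n f)) (∧-exchange (f (suc n)) (f 0) _)

∑-distrib-+ : ∀ n f g → ∑[ i < n ] (f i + g i) ≡ ∑ n f + ∑ n g
∑-distrib-+ zero    f g = refl
∑-distrib-+ (suc n) f g =
  trans (cong (f n + g n +_) (∑-distrib-+ n f g)) (+-interchange (f n) (g n) (∑ n f) (∑ n g))

⋀-distrib-∧ : ∀ n f g → ⋀[ i < n ] (f i ∧ g i) ≡ ⋀ n f ∧ ⋀ n g
⋀-distrib-∧ zero    f g = refl
⋀-distrib-∧ (suc n) f g =
  trans (cong ((f n ∧ g n) ∧_) (⋀-distrib-∧ n f g)) (∧-interchange (f n) (g n) (⋀ n f) (⋀ n g))

*-distribʳ-∑ : ∀ n f c → ∑ n f * c ≡ ∑[ i < n ] (f i * c)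
*-distribʳ-∑ zero    f c = refl
*-distribʳ-∑ (suc n) f c = trans (*-distribʳ-+ c (f n) (∑ n f)) (cong (f n * c +_) (*-distribʳ-∑ n f c))

∑-truncate : ∀ {n L} f → n ≤ L → (∀ i → n ≤ i → i < L → f i ≡ 0) → ∑ L f ≡ ∑ n f
∑-truncate {n} f n≤L vanish = go (≤⇒≤′ n≤L) (λ i n≤i i<L → vanish i n≤i i<L)
  where
  go : ∀ {L} → n ≤′ L → (∀ i → n ≤ i → i < L → f i ≡ 0) → ∑ L f ≡ ∑ n f
  go ≤′-refl              _      = refl
  go (≤′-step {L} n≤′L) vanish′ = begin
    f L + ∑ L f  ≡⟨ cong (_+ ∑ L f) (vanish′ L (≤′⇒≤ n≤′L) (n<1+n L)) ⟩
    ∑ L f        ≡⟨ go n≤′L (λ i n≤i i<L → vanish′ i n≤i (m<n⇒m<1+n i<L)) ⟩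
    ∑ n f        ∎

⋀-truncate : ∀ {n L} f → n ≤ L → (∀ i → n ≤ i → i < L → f i ≡ true) → ⋀ L f ≡ ⋀ n f
⋀-truncate {n} f n≤L hold = go (≤⇒≤′ n≤L) hold
  where
  go : ∀ {L} → n ≤′ L → (∀ i → n ≤ i → i < L → f i ≡ true) → ⋀ L f ≡ ⋀ n f
  go ≤′-refl              _     = refl
  go (≤′-step {L} n≤′L) hold′ = begin
    f L ∧ ⋀ L f  ≡⟨ cong (_∧ ⋀ L f) (hold′ L (≤′⇒≤ n≤′L) (n<1+n L)) ⟩
    ⋀ L f        ≡⟨ go n≤′L (λ i n≤i i<L → hold′ i n≤i (m<n⇒m<1+n i<L)) ⟩
    ⋀ n f        ∎

∑-indicator : ∀ {k y} → y < k → ∀ (u : ℕ → ℕ) → ∑[ c < k ] (if y ≡ᵇ c then u c else 0) ≡ u y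
∑-indicator {k} {y} y<k u = begin
  ∑[ c < k ] (if y ≡ᵇ c then u c else 0)
    ≡⟨ ∑-truncate _ y<k (λ c y<c _ → cong (if_then u c else 0) (≢⇒≡ᵇ-false (<⇒≢ y<c))) ⟩
  (if y ≡ᵇ y then u y else 0) + ∑[ c < y ] (if y ≡ᵇ c then u c else 0)
    ≡⟨ cong₂ _+_ (cong (if_then u y else 0) (≡ᵇ-refl y))
                 (∑-truncate {L = y} _ z≤n (λ c _ c<y → cong (if_then u c else 0) (≢⇒≡ᵇ-false (>⇒≢ c<y)))) ⟩
  u y + 0
    ≡⟨ +-identityʳ (u y) ⟩
  u y ∎

⋀-indicator : ∀ {k y} → y < k → ∀ (f : ℕ → Bool) → ⋀[ c < k ] (if y ≡ᵇ c then f c else true) ≡ f y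
⋀-indicator {k} {y} y<k f = begin
  ⋀[ c < k ] (if y ≡ᵇ c then f c else true)
    ≡⟨ ⋀-truncate _ y<k (λ c y<c _ → cong (if_then f c else true) (≢⇒≡ᵇ-false (<⇒≢ y<c))) ⟩
  (if y ≡ᵇ y then f y else true) ∧ ⋀[ c < y ] (if y ≡ᵇ c then f c else true)
    ≡⟨ cong₂ _∧_ (cong (if_then f y else true) (≡ᵇ-refl y))
                 (⋀-truncate {L = y} _ z≤n (λ c _ c<y → cong (if_then f c else true) (≢⇒≡ᵇ-false (>⇒≢ c<y)))) ⟩
  f y ∧ true
    ≡⟨ ∧-identityʳ (f y) ⟩
  f y ∎

∑-pick : ∀ {k y} → y < k → ∀ (u f : ℕ → ℕ) →
  ∑[ c < k ] (if y ≡ᵇ c then u c else f c) ≡ u y + ∑[ c < k ] (if y ≡ᵇ c then 0 else f c)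
∑-pick {k} {y} y<k u f = begin
  ∑[ c < k ] (if y ≡ᵇ c then u c else f c)
    ≡⟨ ∑-cong k (λ c _ → split (y ≡ᵇ c)) ⟩
  ∑[ c < k ] ((if y ≡ᵇ c then u c else 0) + (if y ≡ᵇ c then 0 else f c))
    ≡⟨ ∑-distrib-+ k _ _ ⟩
  ∑[ c < k ] (if y ≡ᵇ c then u c else 0) + ∑[ c < k ] (if y ≡ᵇ c then 0 else f c)
    ≡⟨ cong (_+ _) (∑-indicator y<k u) ⟩
  u y + ∑[ c < k ] (if y ≡ᵇ c then 0 else f c) ∎
  where
  split : ∀ b {x z} → (if b then x else z) ≡ (if b then x else 0) + (if b then 0 else z)
  split true  = sym (+-identityʳ _)
  split false = refl

sum-map-upTo : ∀ n f → sum (map f (upTo n)) ≡ ∑ n f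
sum-map-upTo zero    f = refl
sum-map-upTo (suc n) f = begin
  sum (map f (upTo (suc n)))            ≡⟨ cong (λ xs → sum (map f xs)) (sym (upTo-∷ʳ n)) ⟩
  sum (map f (upTo n ++ [ n ]))         ≡⟨ cong sum (map-++ f (upTo n) [ n ]) ⟩
  sum (map f (upTo n) ++ [ f n ])       ≡⟨ sum-++ (map f (upTo n)) [ f n ] ⟩
  sum (map f (upTo n)) + (f n + 0)      ≡⟨ cong₂ _+_ (sum-map-upTo n f) (+-identityʳ (f n)) ⟩
  ∑ n f + f n                           ≡⟨ +-comm (∑ n f) (f n) ⟩
  ∑ (suc n) f                           ∎

all-++ : ∀ {A : Set} (f : A → Bool) xs ys → all f (xs ++ ys) ≡ all f xs ∧ all f ys
all-++ f []       ys = refl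
all-++ f (x ∷ xs) ys = trans (cong (f x ∧_) (all-++ f xs ys)) (sym (∧-assoc (f x) _ _))

all-upTo : ∀ n f → all f (upTo n) ≡ ⋀ n f
all-upTo zero    f = refl
all-upTo (suc n) f = begin
  all f (upTo (suc n))           ≡⟨ cong (all f) (sym (upTo-∷ʳ n)) ⟩
  all f (upTo n ++ [ n ])        ≡⟨ all-++ f (upTo n) [ n ] ⟩
  all f (upTo n) ∧ (f n ∧ true)  ≡⟨ cong₂ _∧_ (all-upTo n f) (∧-identityʳ (f n)) ⟩
  ⋀ n f ∧ f n                    ≡⟨ ∧-comm (⋀ n f) (f n) ⟩
  ⋀ (suc n) f                    ∎

∑-pascal : ∀ m (f : ℕ → ℕ) →
  ∑[ j < suc (suc m) ] ((suc m C j) * f j) ≡ ∑[ j < suc m ] ((m C j) * f (suc j)) + ∑[ j < suc m ] ((m C j) * f j)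
∑-pascal m f = begin
  ∑[ j < suc (suc m) ] ((suc m C j) * f j)
    ≡⟨ ∑-head (suc m) (λ j → (suc m C j) * f j) ⟩
  1 * f 0 + ∑[ j < suc m ] ((suc m C suc j) * f (suc j))
    ≡⟨ cong (1 * f 0 +_) (trans (∑-cong (suc m) (λ j _ → pascal j))
                                (∑-distrib-+ (suc m) (λ j → (m C j) * f (suc j))
                                                     (λ j → (m C suc j) * f (suc j)))) ⟩
  1 * f 0 + (X + ∑[ j < suc m ] ((m C suc j) * f (suc j)))
    ≡⟨ +-exchange (1 * f 0) X (∑[ j < suc m ] ((m C suc j) * f (suc j))) ⟩
  X + (1 * f 0 + ∑[ j < suc m ] ((m C suc j) * f (suc j)))
    ≡⟨ cong (X +_) (sym (∑-head (suc m) (λ j → (m C j) * f j))) ⟩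
  X + ((m C suc m) * f (suc m) + ∑[ j < suc m ] ((m C j) * f j))
    ≡⟨ cong (λ c → X + (c * f (suc m) + ∑[ j < suc m ] ((m C j) * f j))) (k>n⇒nCk≡0 (n<1+n m)) ⟩
  X + ∑[ j < suc m ] ((m C j) * f j) ∎
  where
  X = ∑[ j < suc m ] ((m C j) * f (suc j))
  pascal : ∀ j → (suc m C suc j) * f (suc j) ≡ (m C j) * f (suc j) + (m C suc j) * f (suc j)
  pascal j = trans (cong (_* f (suc j)) (sym (nCk+nC[k+1]≡[n+1]C[k+1] m j)))
                   (*-distribʳ-+ (f (suc j)) (m C j) (m C suc j))

countᵇ : {A : Set} → (A → Bool) → List A → ℕ
countᵇ f []       = 0
countᵇ f (x ∷ xs) = if f x then suc (countᵇ f xs) else countᵇ f xs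

countᵇ-++ : ∀ {A : Set} (f : A → Bool) xs ys → countᵇ f (xs ++ ys) ≡ countᵇ f xs + countᵇ f ys
countᵇ-++ f []       ys = refl
countᵇ-++ f (x ∷ xs) ys with f x
... | true  = cong suc (countᵇ-++ f xs ys)
... | false = countᵇ-++ f xs ys

countᵇ-map-∷ : ∀ {A : Set} (f : List A → Bool) y xs →
  countᵇ f (map (y ∷_) xs) ≡ countᵇ (λ s → f (y ∷ s)) xs
countᵇ-map-∷ f y []       = refl
countᵇ-map-∷ f y (x ∷ xs) with f (y ∷ x)
... | true  = cong suc (countᵇ-map-∷ f y xs)
... | false = countᵇ-map-∷ f y xs

countᵇ-cong : ∀ {A : Set} {f g : A → Bool} xs → (∀ x → f x ≡ g x) → countᵇ f xs ≡ countᵇ g xs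
countᵇ-cong []       eq = refl
countᵇ-cong (x ∷ xs) eq = cong₂ (λ b n → if b then suc n else n) (eq x) (countᵇ-cong xs eq)

countᵇ-false : ∀ {A : Set} {f : A → Bool} xs → (∀ x → f x ≡ false) → countᵇ f xs ≡ 0
countᵇ-false []       _   = refl
countᵇ-false (x ∷ xs) never rewrite never x = countᵇ-false xs never

length-filter : ∀ {A : Set} (f : A → Bool) xs → length (filter (λ s → T? (f s)) xs) ≡ countᵇ f xs
length-filter f []       = refl
length-filter f (x ∷ xs) with f x
... | true  = cong suc (length-filter f xs)
... | false = length-filter f xs

countᵇ-filter : ∀ {A : Set} (f g : A → Bool) xs →
  countᵇ g (filter (λ s → T? (f s)) xs) ≡ countᵇ (λ s → f s ∧ g s) xs
countᵇ-filter f g []       = refl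
countᵇ-filter f g (x ∷ xs) with f x
... | true  = cong (λ n → if g x then suc n else n) (countᵇ-filter f g xs)
... | false = countᵇ-filter f g xs

-- Marked positions and the transfer count

data Mark : Set where
  free nonSingleton singleton : Mark

meets : ℕ → Mark → Bool
meets n free         = true
meets n nonSingleton = not (n ≡ᵇ 1)
meets n singleton    = n ≡ᵇ 1

-- ways a b w: the number of ways to add elements carrying the marks w, given a open blocks and
-- b pending blocks (a single element marked nonSingleton, which still has to be joined).
ways : ℕ → ℕ → List Mark → ℕ
ways a b       (singleton ∷ w)    = ways a b w
ways a b       (free ∷ w)         = a * ways a b w + b * ways (suc a) (pred b) w + ways (suc a) b w
ways a b       (nonSingleton ∷ w) = a * ways a b w + b * ways (suc a) (pred b) w + ways a (suc b) w
ways a zero    []                 = 1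
ways a (suc b) []                 = 0

*-pred : ∀ b (f : ℕ → ℕ) → b * f (suc (pred b)) ≡ b * f b
*-pred zero    f = refl
*-pred (suc b) f = refl

ways-open-pred : ∀ w a b → (∀ a b → ways (suc a) b w ≡ ways a (suc b) w + ways a b w) →
  b * ways (suc (suc a)) (pred b) w ≡ b * (ways a (suc b) w + ways a b w) + b * ways (suc a) (pred b) w
ways-open-pred w a b open-w = begin
  b * ways (suc (suc a)) (pred b) w
    ≡⟨ cong (b *_) (open-w (suc a) (pred b)) ⟩
  b * (ways (suc a) (suc (pred b)) w + ways (suc a) (pred b) w)
    ≡⟨ *-distribˡ-+ b _ _ ⟩
  b * ways (suc a) (suc (pred b)) w + b * ways (suc a) (pred b) w
    ≡⟨ cong (_+ b * ways (suc a) (pred b) w) (*-pred b (λ c → ways (suc a) c w)) ⟩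
  b * ways (suc a) b w + b * ways (suc a) (pred b) w
    ≡⟨ cong (λ z → b * z + b * ways (suc a) (pred b) w) (open-w a b) ⟩
  b * (ways a (suc b) w + ways a b w) + b * ways (suc a) (pred b) w ∎

-- An open block is either joined again later, exactly like a pending block, or never again,
-- in which case it can be forgotten.
ways-open : ∀ w a b → ways (suc a) b w ≡ ways a (suc b) w + ways a b w
ways-open []                 a zero    = refl
ways-open []                 a (suc b) = refl
ways-open (singleton ∷ w)    a b = ways-open w a b
ways-open (free ∷ w)         a b
  rewrite ways-open-pred w a b (ways-open w) | ways-open w (suc a) b | ways-open w a b
  = rearrange a b _ _ (ways (suc a) (pred b) w) (ways (suc a) (suc b) w)
  where
  rearrange : ∀ a b P Q S T → suc a * (P + Q) + (b * (P + Q) + b * S) + (T + (P + Q))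
                            ≡ a * P + suc b * (P + Q) + T + (a * Q + b * S + (P + Q))
  rearrange = solve-∀
ways-open (nonSingleton ∷ w) a b
  rewrite ways-open-pred w a b (ways-open w) | ways-open w a (suc b) | ways-open w a b
  = rearrange a b _ _ (ways (suc a) (pred b) w) (ways a (suc (suc b)) w)
  where
  rearrange : ∀ a b P Q S T → suc a * (P + Q) + (b * (P + Q) + b * S) + (T + P)
                            ≡ a * P + suc b * (P + Q) + T + (a * Q + b * S + P)
  rearrange = solve-∀

*-+-split : ∀ a b X₁ Y₁ X₂ Y₂ X₃ Y₃ → a * (X₁ + Y₁) + b * (X₂ + Y₂) + (X₃ + Y₃)
                                   ≡ (a * X₁ + b * X₂ + X₃) + (a * Y₁ + b * Y₂ + Y₃)
*-+-split = solve-∀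

ways-free : ∀ q a b w → ways a b (q ++ free ∷ w) ≡ ways a b (q ++ nonSingleton ∷ w) + ways a b (q ++ w)
ways-free []                 a b w
  rewrite ways-open w a b = sym (+-assoc (a * ways a b w + b * ways (suc a) (pred b) w) _ _)
ways-free (singleton ∷ q)    a b w = ways-free q a b w
ways-free (free ∷ q)         a b w
  rewrite ways-free q a b w | ways-free q (suc a) (pred b) w | ways-free q (suc a) b w = *-+-split a b _ _ _ _ _ _
ways-free (nonSingleton ∷ q) a b w
  rewrite ways-free q a b w | ways-free q (suc a) (pred b) w | ways-free q a (suc b) w = *-+-split a b _ _ _ _ _ _

ways-singleton : ∀ q a b w → ways a b (q ++ singleton ∷ w) ≡ ways a b (q ++ w)
ways-singleton []                 a b w = refl
ways-singleton (singleton ∷ q)    a b w = ways-singleton q a b w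
ways-singleton (free ∷ q)         a b w
  rewrite ways-singleton q a b w | ways-singleton q (suc a) (pred b) w | ways-singleton q (suc a) b w = refl
ways-singleton (nonSingleton ∷ q) a b w
  rewrite ways-singleton q a b w | ways-singleton q (suc a) (pred b) w | ways-singleton q a (suc b) w = refl

ways-replicate-free : ∀ k a b → ways a b (replicate k free) ≡ ways (suc a) b (replicate k nonSingleton)
ways-replicate-free zero    a zero    = refl
ways-replicate-free zero    a (suc b) = refl
ways-replicate-free (suc k) a b
  rewrite ways-replicate-free k a b | ways-replicate-free k (suc a) (pred b) | ways-replicate-free k (suc a) b
        | ways-open (replicate k nonSingleton) (suc a) b
  = rearrange a b _ _ _
  where
  rearrange : ∀ a b X Y Z → a * X + b * Y + (Z + X) ≡ suc a * X + b * Y + Z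
  rearrange = solve-∀

-- Block statuses

-- The state of a block after the marks of its elements: pending is a lone element marked
-- nonSingleton, isolated a lone element marked singleton, broken a violated mark that no
-- later element can repair.
data Status : Set where
  absent ok pending isolated broken : Status

addMark : Status → Mark → Status
addMark absent   free         = ok
addMark absent   nonSingleton = pending
addMark absent   singleton    = isolated
addMark ok       singleton    = broken
addMark ok       _            = ok
addMark pending  singleton    = broken
addMark pending  _            = ok
addMark isolated _            = broken
addMark broken   _            = broken

settled : Status → Bool
settled pending = false
settled broken  = false
settled _       = true

[ok] [pending] [broken] : Status → ℕ
[ok] ok = 1
[ok] _  = 0
[pending] pending = 1
[pending] _       = 0
[broken] broken = 1
[broken] _      = 0

addMark-≢absent : ∀ s μ → addMark s μ ≢ absent
addMark-≢absent absent   free         ()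
addMark-≢absent absent   nonSingleton ()
addMark-≢absent absent   singleton    ()
addMark-≢absent ok       free         ()
addMark-≢absent ok       nonSingleton ()
addMark-≢absent ok       singleton    ()
addMark-≢absent pending  free         ()
addMark-≢absent pending  nonSingleton ()
addMark-≢absent pending  singleton    ()
addMark-≢absent isolated _            ()
addMark-≢absent broken   _            ()

foldl-addMark-≢absent : ∀ s μ ms → foldl addMark s (μ ∷ ms) ≢ absent
foldl-addMark-≢absent s μ []        = addMark-≢absent s μ
foldl-addMark-≢absent s μ (μ′ ∷ ms) = foldl-addMark-≢absent (addMark s μ) μ′ ms

foldl-addMark-broken : ∀ ms → foldl addMark broken ms ≡ broken
foldl-addMark-broken []       = refl
foldl-addMark-broken (_ ∷ ms) = foldl-addMark-broken ms

addMark-pending : ∀ μ → addMark pending μ ≡ addMark ok μ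
addMark-pending free         = refl
addMark-pending nonSingleton = refl
addMark-pending singleton    = refl

settled-foldl-ok : ∀ n ms → settled (foldl addMark ok ms) ≡ all (meets (suc (suc n))) ms
settled-foldl-ok n []                  = refl
settled-foldl-ok n (free ∷ ms)         = settled-foldl-ok n ms
settled-foldl-ok n (nonSingleton ∷ ms) = settled-foldl-ok n ms
settled-foldl-ok n (singleton ∷ ms)    = cong settled (foldl-addMark-broken ms)

settled-status : ∀ ms → settled (foldl addMark absent ms) ≡ all (meets (length ms)) ms
settled-status []                          = refl
settled-status (free ∷ [])                 = refl
settled-status (nonSingleton ∷ [])         = refl
settled-status (singleton ∷ [])            = refl
settled-status (free ∷ μ ∷ ms)             = settled-foldl-ok (length ms) (μ ∷ ms)
settled-status (nonSingleton ∷ μ ∷ ms)     =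
  trans (cong (λ s → settled (foldl addMark s ms)) (addMark-pending μ)) (settled-foldl-ok (length ms) (μ ∷ ms))
settled-status (singleton ∷ μ ∷ ms)        = cong settled (foldl-addMark-broken ms)

ways⊥ : ℕ → ℕ → ℕ → List Mark → ℕ
ways⊥ a b zero    w = ways a b w
ways⊥ a b (suc _) w = 0

-- The count after the next element, carrying the given mark, joins an ok (resp. pending) block.
joinOk joinPending : Mark → ℕ → ℕ → ℕ → List Mark → ℕ
joinOk      singleton a b x w = 0
joinOk      _         a b x w = ways⊥ a b x w
joinPending singleton a b x w = 0
joinPending _         a b x w = ways⊥ (suc a) (pred b) x w

ways⊥-addMark : ∀ s μ a b x w → s ≢ absent →
  ways⊥ ([ok] (addMark s μ) + a) ([pending] (addMark s μ) + b) ([broken] (addMark s μ) + x) w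
    ≡ [ok] s * joinOk μ ([ok] s + a) ([pending] s + b) ([broken] s + x) w
      + [pending] s * joinPending μ ([ok] s + a) ([pending] s + b) ([broken] s + x) w
ways⊥-addMark absent   μ            a b x w present = ⊥-elim (present refl)
ways⊥-addMark ok       free         a b x w _ = sym (trans (+-identityʳ _) (+-identityʳ _))
ways⊥-addMark ok       nonSingleton a b x w _ = sym (trans (+-identityʳ _) (+-identityʳ _))
ways⊥-addMark ok       singleton    a b x w _ = refl
ways⊥-addMark pending  free         a b x w _ = sym (+-identityʳ _)
ways⊥-addMark pending  nonSingleton a b x w _ = sym (+-identityʳ _)
ways⊥-addMark pending  singleton    a b x w _ = refl
ways⊥-addMark isolated μ            a b x w _ = refl
ways⊥-addMark broken   μ            a b x w _ = refl

ways⊥-step : ∀ μ a b x w →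
  ways⊥ ([ok] (addMark absent μ) + a) ([pending] (addMark absent μ) + b) ([broken] (addMark absent μ) + x) w
    + (a * joinOk μ a b x w + b * joinPending μ a b x w)
    ≡ ways⊥ a b x (μ ∷ w)
ways⊥-step free         a b zero    w = +-comm (ways (suc a) b w) _
ways⊥-step nonSingleton a b zero    w = +-comm (ways a (suc b) w) _
ways⊥-step singleton    a b zero    w =
  trans (cong (ways a b w +_) (cong₂ _+_ (*-zeroʳ a) (*-zeroʳ b))) (+-identityʳ _)
ways⊥-step free         a b (suc x) w = cong₂ _+_ (*-zeroʳ a) (*-zeroʳ b)
ways⊥-step nonSingleton a b (suc x) w = cong₂ _+_ (*-zeroʳ a) (*-zeroʳ b)
ways⊥-step singleton    a b (suc x) w = cong₂ _+_ (*-zeroʳ a) (*-zeroʳ b)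

ways⊥-[]-irrelevant : ∀ a a′ b x → ways⊥ a b x [] ≡ ways⊥ a′ b x []
ways⊥-[]-irrelevant a a′ zero    zero    = refl
ways⊥-[]-irrelevant a a′ (suc b) zero    = refl
ways⊥-[]-irrelevant a a′ b       (suc x) = refl

ways⊥-[]-pending : ∀ a b x → ways⊥ a (suc b) x [] ≡ 0
ways⊥-[]-pending a b zero    = refl
ways⊥-[]-pending a b (suc x) = refl

tally : (Status → ℕ) → (ℕ → Status) → ℕ → ℕ
tally h st k = ∑[ c < k ] h (st c)

atTally : {A : Set} → (ℕ → ℕ → ℕ → A) → (ℕ → Status) → ℕ → A
atTally F st k = F (tally [ok] st k) (tally [pending] st k) (tally [broken] st k)

waysFrom : (ℕ → Status) → ℕ → List Mark → ℕ
waysFrom = atTally ways⊥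

waysFrom-cong : ∀ {st st′} k w → (∀ c → st c ≡ st′ c) → waysFrom st k w ≡ waysFrom st′ k w
waysFrom-cong {st} {st′} k w eq =
  cong₃ (λ a b x → ways⊥ a b x w) (tally-cong [ok]) (tally-cong [pending]) (tally-cong [broken])
  where
  tally-cong : ∀ h → tally h st k ≡ tally h st′ k
  tally-cong h = ∑-cong k (λ c _ → cong h (eq c))

tallyWithout : (Status → ℕ) → (ℕ → Status) → ℕ → ℕ → ℕ
tallyWithout h st y k = ∑[ c < k ] (if y ≡ᵇ c then 0 else h (st c))

update : (ℕ → Status) → ℕ → Mark → ℕ → Status
update st y μ c = if y ≡ᵇ c then addMark (st c) μ else st c

tally-update : ∀ h st μ {k y} → y < k →
  tally h (update st y μ) k ≡ h (addMark (st y) μ) + tallyWithout h st y k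
tally-update h st μ {k} {y} y<k =
  trans (∑-cong k (λ c _ → if-float h (y ≡ᵇ c)))
        (∑-pick y<k (λ c → h (addMark (st c) μ)) (λ c → h (st c)))

tally-remove : ∀ h st {k y} → y < k → tally h st k ≡ h (st y) + tallyWithout h st y k
tally-remove h st {k} {y} y<k =
  trans (∑-cong k (λ c _ → sym (if-eta (y ≡ᵇ c)))) (∑-pick y<k (λ c → h (st c)) (λ c → h (st c)))

tally-fresh : ∀ h st μ k → st k ≡ absent →
  tally h (update st k μ) (suc k) ≡ h (addMark absent μ) + tally h st k
tally-fresh h st μ k fresh = cong₂ _+_ new old
  where
  new : h (update st k μ k) ≡ h (addMark absent μ)
  new rewrite ≡ᵇ-refl k | fresh = refl
  old : tally h (update st k μ) k ≡ tally h st k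
  old = ∑-cong k (λ c c<k → cong (λ b → h (if b then addMark (st c) μ else st c))
                                 (≢⇒≡ᵇ-false (>⇒≢ c<k)))

waysFrom-update : ∀ st μ w {k y} → y < k → st y ≢ absent →
  waysFrom (update st y μ) k w
    ≡ [ok] (st y) * atTally (joinOk μ) st k w + [pending] (st y) * atTally (joinPending μ) st k w
waysFrom-update st μ w {k} {y} y<k present =
  trans (cong₃ (λ a b x → ways⊥ a b x w) (after [ok]) (after [pending]) (after [broken]))
        (trans (ways⊥-addMark (st y) μ (R [ok]) (R [pending]) (R [broken]) w present)
               (sym (cong₃ (λ a b x → [ok] (st y) * joinOk μ a b x w + [pending] (st y) * joinPending μ a b x w)
                           (before [ok]) (before [pending]) (before [broken]))))
  where
  R : (Status → ℕ) → ℕ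
  R h = tallyWithout h st y k
  after : ∀ h → tally h (update st y μ) k ≡ h (addMark (st y) μ) + R h
  after h = tally-update h st μ y<k
  before : ∀ h → tally h st k ≡ h (st y) + R h
  before h = tally-remove h st y<k

waysFrom-step : ∀ st k μ w → (∀ c → c < k → st c ≢ absent) → st k ≡ absent →
  waysFrom (update st k μ) (suc k) w + ∑[ y < k ] waysFrom (update st y μ) k w ≡ waysFrom st k (μ ∷ w)
waysFrom-step st k μ w used fresh = begin
  waysFrom (update st k μ) (suc k) w + ∑[ y < k ] waysFrom (update st y μ) k w
    ≡⟨ cong₂ _+_ (cong₃ (λ a b x → ways⊥ a b x w)
                        (tally-fresh [ok] st μ k fresh) (tally-fresh [pending] st μ k fresh)
                        (tally-fresh [broken] st μ k fresh))
                 (∑-cong k (λ y y<k → waysFrom-update st μ w y<k (used y y<k))) ⟩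
  ways⊥ ([ok] s + O) ([pending] s + P) ([broken] s + X) w + ∑[ y < k ] ([ok] (st y) * J₁ + [pending] (st y) * J₂)
    ≡⟨ cong (ways⊥ ([ok] s + O) ([pending] s + P) ([broken] s + X) w +_) collect ⟩
  ways⊥ ([ok] s + O) ([pending] s + P) ([broken] s + X) w + (O * J₁ + P * J₂)
    ≡⟨ ways⊥-step μ O P X w ⟩
  waysFrom st k (μ ∷ w) ∎
  where
  s = addMark absent μ
  O = tally [ok] st k
  P = tally [pending] st k
  X = tally [broken] st k
  J₁ = atTally (joinOk μ) st k w
  J₂ = atTally (joinPending μ) st k w
  collect : ∑[ y < k ] ([ok] (st y) * J₁ + [pending] (st y) * J₂) ≡ O * J₁ + P * J₂
  collect = trans (∑-distrib-+ k _ _) (sym (cong₂ _+_ (*-distribʳ-∑ k _ J₁) (*-distribʳ-∑ k _ J₂)))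

waysFrom-[] : ∀ st k → (if ⋀[ c < k ] settled (st c) then 1 else 0) ≡ waysFrom st k []
waysFrom-[] st zero = refl
waysFrom-[] st (suc k) with st k
... | absent   = waysFrom-[] st k
... | isolated = waysFrom-[] st k
... | ok       = trans (waysFrom-[] st k) (ways⊥-[]-irrelevant _ _ (tally [pending] st k) (tally [broken] st k))
... | pending  = sym (ways⊥-[]-pending _ (tally [pending] st k) (tally [broken] st k))
... | broken   = refl

-- Counting restricted growth strings with marks

occ-++ : ∀ c p q → occ c (p ++ q) ≡ occ c p + occ c q
occ-++ c []      q = refl
occ-++ c (x ∷ p) q with x ≡ᵇ c
... | true  = cong suc (occ-++ c p q)
... | false = occ-++ c p q

marksAt : ℕ → List ℕ → List Mark → List Mark
marksAt c (x ∷ p) (μ ∷ ms) = if x ≡ᵇ c then μ ∷ marksAt c p ms else marksAt c p ms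
marksAt c _       _        = []

statusOf : List ℕ → List Mark → ℕ → Status
statusOf p ms c = foldl addMark absent (marksAt c p ms)

length-marksAt : ∀ c p ms → length p ≡ length ms → length (marksAt c p ms) ≡ occ c p
length-marksAt c []      []       _  = refl
length-marksAt c (x ∷ p) (μ ∷ ms) eq with x ≡ᵇ c
... | true  = cong suc (length-marksAt c p ms (suc-injective eq))
... | false = length-marksAt c p ms (suc-injective eq)

marksAt-∷ʳ : ∀ c p ms y μ → length p ≡ length ms →
  marksAt c (p ++ [ y ]) (ms ++ [ μ ]) ≡ marksAt c p ms ++ (if y ≡ᵇ c then [ μ ] else [])
marksAt-∷ʳ c []      []       y μ _  = refl
marksAt-∷ʳ c (x ∷ p) (ν ∷ ms) y μ eq with x ≡ᵇ c
... | true  = cong (ν ∷_) (marksAt-∷ʳ c p ms y μ (suc-injective eq))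
... | false = marksAt-∷ʳ c p ms y μ (suc-injective eq)

statusOf-∷ʳ : ∀ p ms y μ → length p ≡ length ms →
  ∀ c → statusOf (p ++ [ y ]) (ms ++ [ μ ]) c ≡ update (statusOf p ms) y μ c
statusOf-∷ʳ p ms y μ eq c rewrite marksAt-∷ʳ c p ms y μ eq with y ≡ᵇ c
... | true  = foldl-∷ʳ addMark absent μ (marksAt c p ms)
... | false = cong (foldl addMark absent) (++-identityʳ (marksAt c p ms))

statusOf-unused : ∀ {c} p ms → length p ≡ length ms → occ c p ≡ 0 → statusOf p ms c ≡ absent
statusOf-unused {c} p ms eq unused with marksAt c p ms | length-marksAt c p ms eq
... | []    | _   = refl
... | _ ∷ _ | len = ⊥-elim (0≢1+n (trans (sym unused) (sym len)))

statusOf-used : ∀ {c} p ms → length p ≡ length ms → occ c p ≢ 0 → statusOf p ms c ≢ absent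
statusOf-used {c} p ms eq used with marksAt c p ms | length-marksAt c p ms eq
... | []     | len = ⊥-elim (used (sym len))
... | μ ∷ ms′ | _   = foldl-addMark-≢absent absent μ ms′

record UsesLabels (k : ℕ) (p : List ℕ) : Set where
  field
    used   : ∀ c → c < k → occ c p ≢ 0
    unused : ∀ c → k ≤ c → occ c p ≡ 0

usesLabels-[] : UsesLabels 0 []
usesLabels-[] = record { used = λ _ (); unused = λ _ _ → refl }

usesLabels-old : ∀ {k p y} → y < k → UsesLabels k p → UsesLabels k (p ++ [ y ])
usesLabels-old {k} {p} {y} y<k uses = record { used = used′ ; unused = unused′ }
  where
  open UsesLabels uses
  used′ : ∀ c → c < k → occ c (p ++ [ y ]) ≢ 0
  used′ c c<k rewrite occ-++ c p [ y ] = used c c<k ∘ m+n≡0⇒m≡0 (occ c p)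
  unused′ : ∀ c → k ≤ c → occ c (p ++ [ y ]) ≡ 0
  unused′ c k≤c rewrite occ-++ c p [ y ] | unused c k≤c | ≢⇒≡ᵇ-false (<⇒≢ (<-≤-trans y<k k≤c)) = refl

usesLabels-new : ∀ {k p} → UsesLabels k p → UsesLabels (suc k) (p ++ [ k ])
usesLabels-new {k} {p} uses = record { used = used′ ; unused = unused′ }
  where
  open UsesLabels uses
  used′ : ∀ c → c < suc k → occ c (p ++ [ k ]) ≢ 0
  used′ c c<1+k rewrite occ-++ c p [ k ] with m≤n⇒m<n∨m≡n (≤-pred c<1+k)
  ... | inj₁ c<k  = used c c<k ∘ m+n≡0⇒m≡0 (occ c p)
  ... | inj₂ refl rewrite ≡ᵇ-refl c = (λ ()) ∘ m+n≡0⇒n≡0 (occ c p)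
  unused′ : ∀ c → suc k ≤ c → occ c (p ++ [ k ]) ≡ 0
  unused′ c k<c rewrite occ-++ c p [ k ] | unused c (<⇒≤ k<c) | ≢⇒≡ᵇ-false (<⇒≢ k<c) = refl

usesLabels-bound : ∀ {k p} → UsesLabels k p → All (_< k) p
usesLabels-bound {k} {p} uses = below p (UsesLabels.unused uses)
  where
  below : ∀ p → (∀ c → k ≤ c → occ c p ≡ 0) → All (_< k) p
  below []      _      = []
  below (x ∷ p) unused = x<k ∷ below p unused-tail
    where
    occ-here : occ x (x ∷ p) ≡ suc (occ x p)
    occ-here rewrite ≡ᵇ-refl x = refl
    x<k : x < k
    x<k = ≰⇒> (λ k≤x → 0≢1+n (trans (sym (unused x k≤x)) occ-here))
    unused-tail : ∀ c → k ≤ c → occ c p ≡ 0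
    unused-tail c k≤c with unused c k≤c
    ... | occ≡0 with x ≡ᵇ c
    ...   | true  = ⊥-elim (0≢1+n (sym occ≡0))
    ...   | false = occ≡0

marksHold : List ℕ → List Mark → List ℕ → Bool
marksHold W (μ ∷ ms) (x ∷ s) = meets (occ x W) μ ∧ marksHold W ms s
marksHold W _        _       = true

marksHold-byLabel : ∀ W k p ms → All (_< k) p → length p ≡ length ms →
  marksHold W ms p ≡ ⋀[ c < k ] all (meets (occ c W)) (marksAt c p ms)
marksHold-byLabel W k []      []       []          _  = sym (⋀-truncate {L = k} _ z≤n (λ _ _ _ → refl))
marksHold-byLabel W k (x ∷ p) (μ ∷ ms) (x<k ∷ p<k) eq = begin
  meets (occ x W) μ ∧ marksHold W ms p
    ≡⟨ cong₂ _∧_ (sym (⋀-indicator x<k (λ c → meets (occ c W) μ)))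
                 (marksHold-byLabel W k p ms p<k (suc-injective eq)) ⟩
  ⋀[ c < k ] (if x ≡ᵇ c then meets (occ c W) μ else true) ∧ ⋀[ c < k ] all (meets (occ c W)) (marksAt c p ms)
    ≡⟨ sym (⋀-distrib-∧ k _ _) ⟩
  ⋀[ c < k ] ((if x ≡ᵇ c then meets (occ c W) μ else true) ∧ all (meets (occ c W)) (marksAt c p ms))
    ≡⟨ ⋀-cong k (λ c _ → atLabel c) ⟩
  ⋀[ c < k ] all (meets (occ c W)) (marksAt c (x ∷ p) (μ ∷ ms)) ∎
  where
  atLabel : ∀ c → ((if x ≡ᵇ c then meets (occ c W) μ else true) ∧ all (meets (occ c W)) (marksAt c p ms))
                  ≡ all (meets (occ c W)) (marksAt c (x ∷ p) (μ ∷ ms))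
  atLabel c with x ≡ᵇ c
  ... | true  = refl
  ... | false = refl

marksHold-settled : ∀ k p ms → UsesLabels k p → length p ≡ length ms →
  marksHold p ms p ≡ ⋀[ c < k ] settled (statusOf p ms c)
marksHold-settled k p ms uses eq =
  trans (marksHold-byLabel p k p ms (usesLabels-bound uses) eq) (⋀-cong k (λ c _ → atLabel c))
  where
  atLabel : ∀ c → all (meets (occ c p)) (marksAt c p ms) ≡ settled (statusOf p ms c)
  atLabel c = trans (cong (λ n → all (meets n) (marksAt c p ms)) (sym (length-marksAt c p ms eq)))
                    (sym (settled-status (marksAt c p ms)))

countᵇ-allSeqs-suc : ∀ f b n →
  countᵇ f (allSeqs b (suc n)) ≡ ∑[ y < b ] countᵇ (λ s → f (y ∷ s)) (allSeqs b n)
countᵇ-allSeqs-suc f b n = trans (byFirst (upTo b)) (sum-map-upTo b _)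
  where
  byFirst : ∀ ys → countᵇ f (concatMap (λ y → map (y ∷_) (allSeqs b n)) ys)
                   ≡ sum (map (λ y → countᵇ (λ s → f (y ∷ s)) (allSeqs b n)) ys)
  byFirst []       = refl
  byFirst (y ∷ ys) = trans (countᵇ-++ f (map (y ∷_) (allSeqs b n)) _)
                           (cong₂ _+_ (countᵇ-map-∷ f y (allSeqs b n)) (byFirst ys))

countᵇ-allSeqs-cong : ∀ {f g} b n → (∀ s → length s ≡ n → f s ≡ g s) →
  countᵇ f (allSeqs b n) ≡ countᵇ g (allSeqs b n)
countᵇ-allSeqs-cong b zero    eq = cong (λ x → if x then 1 else 0) (eq [] refl)
countᵇ-allSeqs-cong {f} {g} b (suc n) eq = begin
  countᵇ f (allSeqs b (suc n))                      ≡⟨ countᵇ-allSeqs-suc f b n ⟩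
  ∑[ y < b ] countᵇ (λ s → f (y ∷ s)) (allSeqs b n)
    ≡⟨ ∑-cong b (λ y _ → countᵇ-allSeqs-cong b n (λ s len → eq (y ∷ s) (cong suc len))) ⟩
  ∑[ y < b ] countᵇ (λ s → g (y ∷ s)) (allSeqs b n) ≡⟨ sym (countᵇ-allSeqs-suc g b n) ⟩
  countᵇ g (allSeqs b (suc n))                      ∎

completions : ℕ → List ℕ → List Mark → ℕ → List Mark → ℕ
completions L p ms k w =
  countᵇ (λ s → isRGSFrom k s ∧ marksHold (p ++ s) (ms ++ w) (p ++ s)) (allSeqs L (length w))

completions-∷ : ∀ L μ w p ms k → k < L →
  completions L p ms k (μ ∷ w)
    ≡ completions L (p ++ [ k ]) (ms ++ [ μ ]) (suc k) w + ∑[ y < k ] completions L (p ++ [ y ]) (ms ++ [ μ ]) k w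
completions-∷ L μ w p ms k k<L = begin
  completions L p ms k (μ ∷ w)
    ≡⟨ countᵇ-allSeqs-suc _ L (length w) ⟩
  ∑[ y < L ] countᵇ (λ s → isRGSFrom k (y ∷ s) ∧ marksHold (p ++ y ∷ s) (ms ++ μ ∷ w) (p ++ y ∷ s))
                    (allSeqs L (length w))
    ≡⟨ ∑-cong L (λ y _ → extend y) ⟩
  ∑ L F
    ≡⟨ ∑-truncate F k<L (λ y k<y _ → beyond k<y) ⟩
  F k + ∑ k F
    ≡⟨ cong₂ _+_ newBlock (∑-cong k (λ y y<k → oldBlock y<k)) ⟩
  completions L (p ++ [ k ]) (ms ++ [ μ ]) (suc k) w + ∑[ y < k ] completions L (p ++ [ y ]) (ms ++ [ μ ]) k w ∎
  where
  F : ℕ → ℕ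
  F y = if y ≤ᵇ k then completions L (p ++ [ y ]) (ms ++ [ μ ]) (if y ≡ᵇ k then suc k else k) w else 0
  extend : ∀ y → countᵇ (λ s → isRGSFrom k (y ∷ s) ∧ marksHold (p ++ y ∷ s) (ms ++ μ ∷ w) (p ++ y ∷ s))
                        (allSeqs L (length w)) ≡ F y
  extend y with y ≤ᵇ k
  ... | false = countᵇ-false (allSeqs L (length w)) (λ _ → refl)
  ... | true  = countᵇ-cong (allSeqs L (length w)) (λ s →
                  cong₂ (λ q m → isRGSFrom (if y ≡ᵇ k then suc k else k) s ∧ marksHold q m q)
                        (sym (++-assoc p [ y ] s)) (sym (++-assoc ms [ μ ] w)))
  newBlock : F k ≡ completions L (p ++ [ k ]) (ms ++ [ μ ]) (suc k) w
  newBlock rewrite det (≤ᵇ-reflects-≤ k k) (ofʸ ≤-refl) | ≡ᵇ-refl k = refl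
  beyond : ∀ {y} → k < y → F y ≡ 0
  beyond {y} k<y rewrite det (≤ᵇ-reflects-≤ y k) (ofⁿ (<⇒≱ k<y)) = refl
  oldBlock : ∀ {y} → y < k → F y ≡ completions L (p ++ [ y ]) (ms ++ [ μ ]) k w
  oldBlock {y} y<k rewrite det (≤ᵇ-reflects-≤ y k) (ofʸ (<⇒≤ y<k)) | ≢⇒≡ᵇ-false (<⇒≢ y<k) = refl

completions-ways : ∀ L w p ms k → UsesLabels k p → length p ≡ length ms → k + length w ≤ L →
  completions L p ms k w ≡ waysFrom (statusOf p ms) k w
completions-ways L [] p ms k uses eq _ = begin
  (if marksHold (p ++ []) (ms ++ []) (p ++ []) then 1 else 0)
    ≡⟨ cong (if_then 1 else 0) (cong₂ (λ q m → marksHold q m q) (++-identityʳ p) (++-identityʳ ms)) ⟩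
  (if marksHold p ms p then 1 else 0)
    ≡⟨ cong (if_then 1 else 0) (marksHold-settled k p ms uses eq) ⟩
  (if ⋀[ c < k ] settled (statusOf p ms c) then 1 else 0)
    ≡⟨ waysFrom-[] (statusOf p ms) k ⟩
  waysFrom (statusOf p ms) k [] ∎
completions-ways L (μ ∷ w) p ms k uses eq k+1+w≤L = begin
  completions L p ms k (μ ∷ w)
    ≡⟨ completions-∷ L μ w p ms k (<-≤-trans (m<m+n k z<s) k+1+w≤L) ⟩
  completions L (p ++ [ k ]) (ms ++ [ μ ]) (suc k) w + ∑[ y < k ] completions L (p ++ [ y ]) (ms ++ [ μ ]) k w
    ≡⟨ cong₂ _+_ (extended (usesLabels-new uses) (≤-trans (≤-reflexive (sym (+-suc k (length w)))) k+1+w≤L))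
                 (∑-cong k (λ y y<k → extended (usesLabels-old y<k uses)
                                               (≤-trans (+-monoʳ-≤ k (n≤1+n _)) k+1+w≤L))) ⟩
  waysFrom (update st k μ) (suc k) w + ∑[ y < k ] waysFrom (update st y μ) k w
    ≡⟨ waysFrom-step st k μ w (λ c c<k → statusOf-used p ms eq (used c c<k))
                              (statusOf-unused p ms eq (unused k ≤-refl)) ⟩
  waysFrom st k (μ ∷ w) ∎
  where
  open UsesLabels uses
  st = statusOf p ms
  extended : ∀ {y k′} → UsesLabels k′ (p ++ [ y ]) → k′ + length w ≤ L →
    completions L (p ++ [ y ]) (ms ++ [ μ ]) k′ w ≡ waysFrom (update st y μ) k′ w
  extended {y} {k′} uses′ bound = trans
    (completions-ways L w (p ++ [ y ]) (ms ++ [ μ ]) k′ uses′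
       (trans (length-++ p) (trans (cong (_+ 1) eq) (sym (length-++ ms)))) bound)
    (waysFrom-cong k′ w (statusOf-∷ʳ p ms y μ eq))

countRGS-ways : ∀ n w → length w ≡ n → countᵇ (λ s → isRGS s ∧ marksHold s w s) (allSeqs n n) ≡ ways 0 0 w
countRGS-ways _ w refl = completions-ways (length w) w [] [] 0 usesLabels-[] refl ≤-refl

-- Bell numbers, singleton-free partitions and A as transfer counts

marksHold-free : ∀ W n s → marksHold W (replicate n free) s ≡ true
marksHold-free W zero    s       = refl
marksHold-free W (suc n) []      = refl
marksHold-free W (suc n) (x ∷ s) = marksHold-free W n s

marksHold-nonSingleton : ∀ W s →
  marksHold W (replicate (length s) nonSingleton) s ≡ all (λ x → not (occ x W ≡ᵇ 1)) s
marksHold-nonSingleton W []      = refl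
marksHold-nonSingleton W (x ∷ s) = cong (not (occ x W ≡ᵇ 1) ∧_) (marksHold-nonSingleton W s)

marksHold-++ : ∀ W ms s {ms′ s′} → length ms ≡ length s →
  marksHold W (ms ++ ms′) (s ++ s′) ≡ marksHold W ms s ∧ marksHold W ms′ s′
marksHold-++ W []       []      _  = refl
marksHold-++ W (μ ∷ ms) (x ∷ s) eq =
  trans (cong (meets (occ x W) μ ∧_) (marksHold-++ W ms s (suc-injective eq))) (sym (∧-assoc (meets (occ x W) μ) _ _))

⋀-labelAt : ∀ h s → ⋀[ i < length s ] h (labelAt i s) ≡ all h s
⋀-labelAt h []      = refl
⋀-labelAt h (x ∷ s) = trans (⋀-head (length s) _) (cong (h x ∧_) (⋀-labelAt h s))

labelAt-++ : ∀ s₁ s₂ i → labelAt (length s₁ + i) (s₁ ++ s₂) ≡ labelAt i s₂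
labelAt-++ []       s₂ i = refl
labelAt-++ (_ ∷ s₁) s₂ i = labelAt-++ s₁ s₂ i

isSingleton-< : ∀ s {i} → i < length s → isSingleton s i ≡ (occ (labelAt i s) s ≡ᵇ 1)
isSingleton-< s {i} i<len rewrite det (<ᵇ-reflects-< i (length s)) (ofʸ i<len) = refl

isSingleton-≥ : ∀ s {i} → length s ≤ i → isSingleton s i ≡ false
isSingleton-≥ s {i} len≤i rewrite det (<ᵇ-reflects-< i (length s)) (ofⁿ (≤⇒≯ len≤i)) = refl

noSingletons-marks : ∀ s → noSingletons s ≡ marksHold s (replicate (length s) nonSingleton) s
noSingletons-marks s = begin
  all (λ i → not (isSingleton s i)) (upTo (length s))
    ≡⟨ all-upTo (length s) _ ⟩
  ⋀[ i < length s ] not (isSingleton s i)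
    ≡⟨ ⋀-cong (length s) (λ i i<len → cong not (isSingleton-< s i<len)) ⟩
  ⋀[ i < length s ] not (occ (labelAt i s) s ≡ᵇ 1)
    ≡⟨ ⋀-labelAt (λ x → not (occ x s ≡ᵇ 1)) s ⟩
  all (λ x → not (occ x s ≡ᵇ 1)) s
    ≡⟨ sym (marksHold-nonSingleton s s) ⟩
  marksHold s (replicate (length s) nonSingleton) s ∎

split-around : ∀ k n (s : List ℕ) → length s ≡ suc (n + k) →
  ∃[ s₁ ] ∃[ x ] ∃[ s₂ ] (s ≡ s₁ ++ x ∷ s₂ × length s₁ ≡ k × length s₂ ≡ n)
split-around zero    n (x ∷ s) eq = [] , x , s , refl , refl , trans (suc-injective eq) (+-identityʳ n)
split-around (suc k) n (y ∷ s) eq with split-around k n s (trans (suc-injective eq) (+-suc n k))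
... | s₁ , x , s₂ , refl , refl , refl = y ∷ s₁ , x , s₂ , refl , refl , refl

largestSingletonIs-marks : ∀ k n s → length s ≡ suc (n + k) →
  largestSingletonIs s k ≡ marksHold s (replicate k free ++ singleton ∷ replicate n nonSingleton) s
largestSingletonIs-marks k n s len with split-around k n s len
... | s₁ , x , s₂ , refl , refl , refl = begin
  isSingleton s a ∧ all (λ j → not (isSingleton s j)) (map after (upTo (length s)))
    ≡⟨ cong₂ _∧_ isolatedAt noneAfter ⟩
  (occ x s ≡ᵇ 1) ∧ all (λ z → not (occ z s ≡ᵇ 1)) s₂
    ≡⟨ sym marks ⟩
  marksHold s (replicate a free ++ singleton ∷ replicate m nonSingleton) s ∎
  where
  a = length s₁
  m = length s₂
  after : ℕ → ℕ
  after t = suc (a + t)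
  length-s : length s ≡ suc (a + m)
  length-s = trans (length-++ s₁) (+-suc a m)
  inRange : ∀ {i} → i < suc (a + m) → isSingleton s i ≡ (occ (labelAt i s) s ≡ᵇ 1)
  inRange {i} i<len = isSingleton-< s (subst (i <_) (sym length-s) i<len)
  outOfRange : ∀ {i} → suc (a + m) ≤ i → isSingleton s i ≡ false
  outOfRange {i} len≤i = isSingleton-≥ s (subst (_≤ i) (sym length-s) len≤i)
  isolatedAt : isSingleton s a ≡ (occ x s ≡ᵇ 1)
  isolatedAt = trans (inRange (s≤s (m≤m+n a m)))
                     (cong (λ z → occ z s ≡ᵇ 1) (trans (cong (λ i → labelAt i s) (sym (+-identityʳ a)))
                                                        (labelAt-++ s₁ (x ∷ s₂) 0)))
  labelAfter : ∀ t → labelAt (after t) s ≡ labelAt t s₂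
  labelAfter t = trans (cong (λ i → labelAt i s) (sym (+-suc a t))) (labelAt-++ s₁ (x ∷ s₂) (suc t))
  noneAfter : all (λ j → not (isSingleton s j)) (map after (upTo (length s)))
                ≡ all (λ z → not (occ z s ≡ᵇ 1)) s₂
  noneAfter = begin
    all (λ j → not (isSingleton s j)) (map after (upTo (length s)))
      ≡⟨ cong and (sym (map-∘ (upTo (length s)))) ⟩
    all (λ t → not (isSingleton s (after t))) (upTo (length s))
      ≡⟨ all-upTo (length s) _ ⟩
    ⋀[ t < length s ] not (isSingleton s (after t))
      ≡⟨ ⋀-truncate _ (subst (m ≤_) (sym length-s) (≤-trans (m≤n+m m a) (n≤1+n _)))
                    (λ t m≤t _ → cong not (outOfRange (s≤s (+-monoʳ-≤ a m≤t)))) ⟩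
    ⋀[ t < m ] not (isSingleton s (after t))
      ≡⟨ ⋀-cong m (λ t t<m → cong not (trans (inRange (s≤s (+-monoʳ-< a t<m)))
                                             (cong (λ z → occ z s ≡ᵇ 1) (labelAfter t)))) ⟩
    ⋀[ t < m ] not (occ (labelAt t s₂) s ≡ᵇ 1)
      ≡⟨ ⋀-labelAt (λ z → not (occ z s ≡ᵇ 1)) s₂ ⟩
    all (λ z → not (occ z s ≡ᵇ 1)) s₂ ∎
  marks : marksHold s (replicate a free ++ singleton ∷ replicate m nonSingleton) s
            ≡ (occ x s ≡ᵇ 1) ∧ all (λ z → not (occ z s ≡ᵇ 1)) s₂
  marks = trans (marksHold-++ s (replicate a free) s₁ (length-replicate a))
                (cong₂ _∧_ (marksHold-free s a s₁) (cong ((occ x s ≡ᵇ 1) ∧_) (marksHold-nonSingleton s s₂)))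

Bʷ Vʷ : ℕ → ℕ
Bʷ n = ways 0 0 (replicate n free)
Vʷ n = ways 0 0 (replicate n nonSingleton)

W : ℕ → ℕ → ℕ
W m n = ways 0 0 (replicate m free ++ replicate n nonSingleton)

B≡Bʷ : ∀ n → B n ≡ Bʷ n
B≡Bʷ n = begin
  length (filter (λ s → T? (isRGS s)) (allSeqs n n))
    ≡⟨ length-filter isRGS (allSeqs n n) ⟩
  countᵇ isRGS (allSeqs n n)
    ≡⟨ countᵇ-cong (allSeqs n n)
         (λ s → sym (trans (cong (isRGS s ∧_) (marksHold-free s n s)) (∧-identityʳ (isRGS s)))) ⟩
  countᵇ (λ s → isRGS s ∧ marksHold s (replicate n free) s) (allSeqs n n)
    ≡⟨ countRGS-ways n (replicate n free) (length-replicate n) ⟩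
  Bʷ n ∎

V≡Vʷ : ∀ n → V n ≡ Vʷ n
V≡Vʷ n = begin
  length (filter (λ s → T? (noSingletons s)) (filter (λ s → T? (isRGS s)) (allSeqs n n)))
    ≡⟨ length-filter noSingletons (filter (λ s → T? (isRGS s)) (allSeqs n n)) ⟩
  countᵇ noSingletons (filter (λ s → T? (isRGS s)) (allSeqs n n))
    ≡⟨ countᵇ-filter isRGS noSingletons (allSeqs n n) ⟩
  countᵇ (λ s → isRGS s ∧ noSingletons s) (allSeqs n n)
    ≡⟨ countᵇ-allSeqs-cong n n (λ s len → cong (isRGS s ∧_)
         (trans (noSingletons-marks s) (cong (λ l → marksHold s (replicate l nonSingleton) s) len))) ⟩
  countᵇ (λ s → isRGS s ∧ marksHold s (replicate n nonSingleton) s) (allSeqs n n)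
    ≡⟨ countRGS-ways n (replicate n nonSingleton) (length-replicate n) ⟩
  Vʷ n ∎

A≡W : ∀ k n → A (n + k) k ≡ W k n
A≡W k n = begin
  length (filter (λ s → T? (largestSingletonIs s k)) (filter (λ s → T? (isRGS s)) (allSeqs L L)))
    ≡⟨ length-filter (λ s → largestSingletonIs s k) (filter (λ s → T? (isRGS s)) (allSeqs L L)) ⟩
  countᵇ (λ s → largestSingletonIs s k) (filter (λ s → T? (isRGS s)) (allSeqs L L))
    ≡⟨ countᵇ-filter isRGS (λ s → largestSingletonIs s k) (allSeqs L L) ⟩
  countᵇ (λ s → isRGS s ∧ largestSingletonIs s k) (allSeqs L L)
    ≡⟨ countᵇ-allSeqs-cong L L (λ s len → cong (isRGS s ∧_) (largestSingletonIs-marks k n s len)) ⟩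
  countᵇ (λ s → isRGS s ∧ marksHold s w s) (allSeqs L L)
    ≡⟨ countRGS-ways L w length-w ⟩
  ways 0 0 w
    ≡⟨ ways-singleton (replicate k free) 0 0 (replicate n nonSingleton) ⟩
  W k n ∎
  where
  L = suc (n + k)
  w = replicate k free ++ singleton ∷ replicate n nonSingleton
  length-w : length w ≡ L
  length-w = begin
    length w                       ≡⟨ length-++ (replicate k free) ⟩
    length (replicate k free) + suc (length (replicate n nonSingleton))
                                   ≡⟨ cong₂ (λ a b → a + suc b) (length-replicate k) (length-replicate n) ⟩
    k + suc n                      ≡⟨ +-suc k n ⟩
    suc (k + n)                    ≡⟨ cong suc (+-comm k n) ⟩
    L                              ∎

-- Binomial expansions

Bʷ≡Vʷ+Vʷ : ∀ n → Bʷ n ≡ Vʷ (suc n) + Vʷ n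
Bʷ≡Vʷ+Vʷ n = trans (ways-replicate-free n 0 0) (ways-open (replicate n nonSingleton) 0 0)

replicate-++-∷ : ∀ {A : Set} m (x : A) r → replicate m x ++ x ∷ r ≡ x ∷ (replicate m x ++ r)
replicate-++-∷ zero    x r = refl
replicate-++-∷ (suc m) x r = cong (x ∷_) (replicate-++-∷ m x r)

W-suc : ∀ m n → W (suc m) n ≡ W m (suc n) + W m n
W-suc m n = trans (cong (ways 0 0) (sym (replicate-++-∷ m free (replicate n nonSingleton))))
                  (ways-free (replicate m free) 0 0 (replicate n nonSingleton))

W-binomial-V : ∀ m n → W m n ≡ ∑[ j < suc m ] ((m C j) * Vʷ (n + j))
W-binomial-V zero    n = sym (trans (+-identityʳ _) (trans (*-identityˡ _) (cong Vʷ (+-identityʳ n))))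
W-binomial-V (suc m) n = begin
  W (suc m) n
    ≡⟨ W-suc m n ⟩
  W m (suc n) + W m n
    ≡⟨ cong₂ _+_ (W-binomial-V m (suc n)) (W-binomial-V m n) ⟩
  ∑[ j < suc m ] ((m C j) * Vʷ (suc n + j)) + ∑[ j < suc m ] ((m C j) * Vʷ (n + j))
    ≡⟨ cong (_+ ∑[ j < suc m ] ((m C j) * Vʷ (n + j)))
            (∑-cong (suc m) (λ j _ → cong (λ i → (m C j) * Vʷ i) (sym (+-suc n j)))) ⟩
  ∑[ j < suc m ] ((m C j) * Vʷ (n + suc j)) + ∑[ j < suc m ] ((m C j) * Vʷ (n + j))
    ≡⟨ sym (∑-pascal m (λ j → Vʷ (n + j))) ⟩
  ∑[ j < suc (suc m) ] ((suc m C j) * Vʷ (n + j)) ∎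

W-binomial-B : ∀ m n → W (suc m) n ≡ ∑[ j < suc m ] ((m C j) * Bʷ (n + j))
W-binomial-B m n = begin
  W (suc m) n
    ≡⟨ W-suc m n ⟩
  W m (suc n) + W m n
    ≡⟨ cong₂ _+_ (W-binomial-V m (suc n)) (W-binomial-V m n) ⟩
  ∑[ j < suc m ] ((m C j) * Vʷ (suc n + j)) + ∑[ j < suc m ] ((m C j) * Vʷ (n + j))
    ≡⟨ sym (∑-distrib-+ (suc m) (λ j → (m C j) * Vʷ (suc n + j)) (λ j → (m C j) * Vʷ (n + j))) ⟩
  ∑[ j < suc m ] ((m C j) * Vʷ (suc (n + j)) + (m C j) * Vʷ (n + j))
    ≡⟨ ∑-cong (suc m) (λ j _ → trans (sym (*-distribˡ-+ (m C j) _ _))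
                                     (cong ((m C j) *_) (sym (Bʷ≡Vʷ+Vʷ (n + j))))) ⟩
  ∑[ j < suc m ] ((m C j) * Bʷ (n + j)) ∎

A-binomial-V : ∀ n m → A (n + m) m ≡ sum (map (λ j → (m C j) * V (n + j)) (upTo (suc m)))
A-binomial-V n m = begin
  A (n + m) m                              ≡⟨ A≡W m n ⟩
  W m n                                    ≡⟨ W-binomial-V m n ⟩
  ∑[ j < suc m ] ((m C j) * Vʷ (n + j))    ≡⟨ ∑-cong (suc m) (λ j _ → cong ((m C j) *_) (sym (V≡Vʷ (n + j)))) ⟩
  ∑[ j < suc m ] ((m C j) * V (n + j))     ≡⟨ sym (sum-map-upTo (suc m) _) ⟩
  sum (map (λ j → (m C j) * V (n + j)) (upTo (suc m))) ∎

A-binomial-B : ∀ n m → A (n + m + 1) (m + 1) ≡ sum (map (λ j → (m C j) * B (n + j)) (upTo (suc m)))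
A-binomial-B n m = begin
  A (n + m + 1) (m + 1)                    ≡⟨ cong₂ A (trans (+-assoc n m 1) (cong (n +_) (+-comm m 1))) (+-comm m 1) ⟩
  A (n + suc m) (suc m)                    ≡⟨ A≡W (suc m) n ⟩
  W (suc m) n                              ≡⟨ W-binomial-B m n ⟩
  ∑[ j < suc m ] ((m C j) * Bʷ (n + j))    ≡⟨ ∑-cong (suc m) (λ j _ → cong ((m C j) *_) (sym (B≡Bʷ (n + j)))) ⟩
  ∑[ j < suc m ] ((m C j) * B (n + j))     ≡⟨ sym (sum-map-upTo (suc m) _) ⟩
  sum (map (λ j → (m C j) * B (n + j)) (upTo (suc m))) ∎

corollary2p5 : ∀ (n m : ℕ) →
    (A (n + m) m ≡ sum (map (λ j → (m C j) * V (n + j)) (upTo (suc m))))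
      × (A (n + m + 1) (m + 1) ≡ sum (map (λ j → (m C j) * B (n + j)) (upTo (suc m))))
corollary2p5 n m = A-binomial-V n m , A-binomial-B n m
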